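{- Let $r\ge 3$ be an integer, let $a_1,\dots,a_r$ be positive integers, and let $\mathcal{G}=K_{a_1,\dots,a_r}$ be the complete multipartite graph with vertex classes of sizes $a_1,\dots,a_r$. Then $$M(\mathcal{G})=n+\binom{n}{2}+\sum_{\substack{U\subseteq\{1,\dots,r\}\\ \#U\equiv 1\ (\mathrm{mod}\ 2),\ \#U\ge 3}}\ \prod_{i\in U}a_i,$$ where $n=\sum_{i=1}^r a_i$.
   Context: Graphs are finite, simple and undirected. The complete multipartite graph $K_{a_1,\dots,a_r}$ has $n=\sum_i a_i$ vertices partitioned into $r$ classes of sizes $a_1,\dots,a_r$, two vertices being adjacent iff they lie in different classes. For a graph $\mathcal{G}$ with $n$ vertices and adjacency matrix $A$, viewed over $\mathbb{F}_2$, let $C(\mathcal{G})\subseteq\mathbb{F}_2^{2n}$ be the binary linear code generated by the rows of $[I_n|A]$, where $I_n$ is the $n\times n$ identity matrix. The support of a vector is the set of positions of its nonzero entries. A nonzero codeword $c$ of a binary linear code $C$ is minimal if there is no nonzero codeword $c'\in C$ with $\operatorname{supp}(c')\subsetneq\operatorname{supp}(c)$. $M(\mathcal{G})$ denotes the number of minimal codewords of $C(\mathcal{G})$; it does not depend on the labeling of the vertices. -}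

module Defs where

open import Data.Bool.Base using (if_then_else_)
open import Data.Fin.Base using (Fin; zero; suc; splitAt)
open import Data.Fin.Properties using () renaming (_≟_ to _≟ᶠ_)
open import Data.Fin.Subset using (Subset; inside; outside; ∣_∣; _⊂_)
open import Data.Fin.Subset.Properties using (_∈?_; _⊂?_)
open import Data.List.Base as List using (List; []; _∷_; filter; length; allFin; cartesianProductWith)
open import Data.List.Membership.Propositional using (_∈_; lose)
open import Data.List.Membership.Propositional.Properties using (∈-cartesianProductWith⁺)
open import Data.List.Relation.Unary.Any using (here; there; any?; satisfied)
open import Data.Nat.Base using (ℕ; zero; suc; _+_; _≤_; _%_)
open import Data.Nat.ListAction using (product) renaming (sum to sumˡ)
open import Data.Nat.Properties using (_≤?_) renaming (_≟_ to _≟ⁿ_)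
open import Data.Parity.Base as ℙ using (0ℙ; 1ℙ) renaming (Parity to 𝔽₂)
open import Data.Parity.Properties using () renaming (_≟_ to _≟ᵖ_)
open import Data.Product.Base using (∃; _×_; _,_)
open import Data.Sum.Base using ([_,_]′)
open import Data.Vec.Base as Vec using (Vec; []; _∷_; _++_; tabulate; replicate; zipWith; foldr′; lookup)
open import Data.Vec.Properties using (≡-dec)
open import Function.Base using (_∘_; const)
open import Level using (0ℓ)
open import Relation.Binary.Core using (Rel)
open import Relation.Binary.Definitions using (Decidable; Symmetric; Irreflexive; DecidableEquality)
open import Relation.Binary.PropositionalEquality using (_≡_; _≢_; refl; sym)
open import Relation.Nullary using (¬_; Dec; does; ¬?)
open import Relation.Nullary.Decidable using (map′; _×-dec_)
open import Relation.Unary using (Pred) renaming (Decidable to Decidable₁)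

-- Every vector of length n with entries from xs, each listed once if xs
-- has no repetitions.
vecs : ∀ {A : Set} → List A → ∀ n → List (Vec A n)
vecs xs zero    = [] ∷ []
vecs xs (suc n) = cartesianProductWith _∷_ xs (vecs xs n)

∈-vecs : ∀ {A : Set} {xs : List A} → (∀ x → x ∈ xs) → ∀ {n} (v : Vec A n) → v ∈ vecs xs n
∈-vecs all []      = here refl
∈-vecs all (x ∷ v) = ∈-cartesianProductWith⁺ _∷_ (all x) (∈-vecs all v)

Word : ℕ → Set
Word = Vec 𝔽₂

words : ∀ n → List (Word n)
words = vecs (0ℙ ∷ 1ℙ ∷ [])

∈-words : ∀ {n} (w : Word n) → w ∈ words n
∈-words = ∈-vecs λ { 0ℙ → here refl ; 1ℙ → there (here refl) }

anyWord? : ∀ {n} {P : Pred (Word n) 0ℓ} → Decidable₁ P → Dec (∃ P)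
anyWord? {n} P? = map′ satisfied (λ (w , p) → lose (∈-words w) p) (any? P? (words n))

_≟ʷ_ : ∀ {n} → DecidableEquality (Word n)
_≟ʷ_ = ≡-dec _≟ᵖ_

𝟎 : ∀ {n} → Word n
𝟎 = replicate _ 0ℙ

_⊕_ : ∀ {n} → Word n → Word n → Word n
_⊕_ = zipWith ℙ._+_

_·_ : ∀ {n} → 𝔽₂ → Word n → Word n
c · w = Vec.map (c ℙ.*_) w

supp : ∀ {n} → Word n → Subset n
supp = Vec.map λ x → does (¬? (x ≟ᵖ 0ℙ))

-- A matrix is the vector of its rows.
Matrix : ℕ → ℕ → Set
Matrix m n = Vec (Word n) m

linearCombination : ∀ {m n} → Word m → Matrix m n → Word n
linearCombination coeffs rows = foldr′ _⊕_ 𝟎 (zipWith _·_ coeffs rows)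

Code : ℕ → Set₁
Code n = Pred (Word n) 0ℓ

generatedBy : ∀ {m n} → Matrix m n → Code n
generatedBy rows w = ∃ λ coeffs → w ≡ linearCombination coeffs rows

generatedBy? : ∀ {m n} (rows : Matrix m n) → Decidable₁ (generatedBy rows)
generatedBy? rows w = anyWord? λ coeffs → w ≟ʷ linearCombination coeffs rows

IsMinimal : ∀ {n} → Code n → Pred (Word n) 0ℓ
IsMinimal C c = C c × c ≢ 𝟎 × ¬ (∃ λ c′ → C c′ × c′ ≢ 𝟎 × supp c′ ⊂ supp c)

isMinimal? : ∀ {n} {C : Code n} → Decidable₁ C → Decidable₁ (IsMinimal C)
isMinimal? C? c =
  C? c ×-dec ¬? (c ≟ʷ 𝟎) ×-dec
  ¬? (anyWord? λ c′ → C? c′ ×-dec ¬? (c′ ≟ʷ 𝟎) ×-dec supp c′ ⊂? supp c)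

record Graph (n : ℕ) : Set₁ where
  field
    Adjacent    : Rel (Fin n) 0ℓ
    adjacent?   : Decidable Adjacent
    symmetric   : Symmetric Adjacent
    irreflexive : Irreflexive _≡_ Adjacent

indicator : ∀ {P : Set} → Dec P → 𝔽₂
indicator P? = if does P? then 1ℙ else 0ℙ

identityMatrix : ∀ n → Matrix n n
identityMatrix n = tabulate λ u → tabulate λ v → indicator (u ≟ᶠ v)

adjacencyMatrix : ∀ {n} → Graph n → Matrix n n
adjacencyMatrix G = tabulate λ u → tabulate λ v → indicator (adjacent? u v)
  where open Graph G

_∥_ : ∀ {m k l} → Matrix m k → Matrix m l → Matrix m (k + l)
_∥_ = zipWith _++_

generatorMatrix : ∀ {n} → Graph n → Matrix n (n + n)
generatorMatrix {n} G = identityMatrix n ∥ adjacencyMatrix G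

graphCode : ∀ {n} → Graph n → Code (n + n)
graphCode G = generatedBy (generatorMatrix G)

M : ∀ {n} → Graph n → ℕ
M {n} G = length (filter (isMinimal? (generatedBy? (generatorMatrix G))) (words (n + n)))

-- The vertices are numbered class by class: the first a₁ of them form the
-- first class, the next a₂ the second, and so on.
classOf : ∀ {r} (a : Vec ℕ r) → Fin (Vec.sum a) → Fin r
classOf (k ∷ a) v = [ const zero , suc ∘ classOf a ]′ (splitAt k v)

completeMultipartite : ∀ {r} (a : Vec ℕ r) → Graph (Vec.sum a)
completeMultipartite a = record
  { Adjacent    = λ u v → classOf a u ≢ classOf a v
  ; adjacent?   = λ u v → ¬? (classOf a u ≟ᶠ classOf a v)
  ; symmetric   = λ u≁v → u≁v ∘ sym
  ; irreflexive = λ { refl u≁u → u≁u refl }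
  }

subsets : ∀ r → List (Subset r)
subsets = vecs (outside ∷ inside ∷ [])

∑-over : ∀ {r} {P : Pred (Subset r) 0ℓ} → Decidable₁ P → (Subset r → ℕ) → ℕ
∑-over P? f = sumˡ (List.map f (filter P? (subsets _)))

∏-over : ∀ {r} → Subset r → (Fin r → ℕ) → ℕ
∏-over U f = product (List.map f (filter (_∈? U) (allFin _)))

OddAtLeast3 : ∀ {r} → Pred (Subset r) 0ℓ
OddAtLeast3 U = ∣ U ∣ % 2 ≡ 1 × 3 ≤ ∣ U ∣

oddAtLeast3? : ∀ {r} → Decidable₁ (OddAtLeast3 {r})
oddAtLeast3? U = (∣ U ∣ % 2 ≟ⁿ 1) ×-dec (3 ≤? ∣ U ∣)

{-# OPTIONS --safe #-}
module Submission where

-- Write N x for the vector x A, so that the codewords are the vectors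
-- (x | N x), one for each x.  On a vertex v the entry of N x is the number of
-- vertices of x outside the class of v, modulo 2.  Hence it is the parity of
-- |x| if x misses the class of v, and the opposite parity if x meets that
-- class exactly once (N≡parity, N≡parity⁻¹).  As the left half of a codeword
-- determines it, (x | N x) fails to be minimal exactly when some nonzero y
-- with supp y a proper subset of supp x has supp (N y) inside supp (N x);
-- such a y dominates x (minimal⇔).
--
-- * Let 1 ≤ |x| ≤ 2.  A dominating y forces |x| = 2 and |y| = 1.  At a vertex
--   of a class missed by x, which exists as there are at least three nonempty
--   classes, N y is then 1 and N x is 0.  So x is undominated
--   (undominated-≤2).
-- * Let x have odd weight and at most one vertex in each class (call x
--   transversal).  If |y| is odd, look at a vertex of x outside y: there N y
--   is 1 and N x is 0.  If |y| is even, the same happens at any vertex of y.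
--   So x is undominated (undominated-odd).
-- * Let |x| ≥ 3.  If x has two distinct vertices u, w in one class, then N of the word
--   with support u, w vanishes, and that word dominates x
--   (sameClass-dominated).  If x is transversal of even weight, any two
--   distinct vertices u, w of x give a dominating word: its N is supported on the classes of
--   u and w, where N x is 1 as well (even-dominated).
--
-- So the minimal codewords come from the x of weight 1 or 2 and from the
-- transversal x of odd weight at least 3 (minimal⇔shape).  There are n of
-- weight 1 and n C 2 of weight 2 (#weight).  A transversal word is a set U of
-- classes with a vertex chosen in each of them, so those meeting exactly the
-- classes in U number ∏ a_i over i in U (∑-transversal).

open import Defs
open import Data.Nat using (ℕ; _+_; _≤_)
open import Data.Nat.Combinatorics using (_C_)
open import Data.Vec using (Vec; lookup; sum)
open import Relation.Binary.PropositionalEquality using (_≡_)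

import Algebra.Properties.CommutativeMonoid.Sum as SumProperties
open import Data.Bool.Base using (if_then_else_)
open import Data.Empty using (⊥; ⊥-elim)
open import Data.Fin.Base using (Fin; zero; suc; splitAt; _↑ˡ_; _↑ʳ_; join)
open import Data.Fin.Properties as Fin using (all?; any?; splitAt-↑ˡ; splitAt-↑ʳ; join-splitAt)
open import Data.Fin.Subset using (Subset; inside; outside; ∣_∣; _∈_; _∉_; _⊆_; _⊂_; _-_; Nonempty) renaming (⊤ to full)
open import Data.Fin.Subset.Properties
  using (_∈?_; ⊆-antisym; ⊂-irref; p⊂q⇒∣p∣<∣q∣; ∣⊤∣≡n; p─q⊆p; x∈p⇒∣p-x∣<∣p∣; p─⊥≡p)
open import Data.List.Base as List using (List; []; _∷_; filter; length; allFin)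
open import Data.List.Membership.Propositional using () renaming (_∈_ to _∈ˡ_; _∉_ to _∉ˡ_)
open import Data.List.Membership.Propositional.Properties using (∈-map⁺)
open import Data.List.Properties using (length-map; ++-identityʳ; map-tabulate)
open import Data.List.Relation.Unary.Any using (here; there)
open import Data.Nat.Base using (zero; suc; z≤n; s≤s; s≤s⁻¹; _*_; _<_; _%_; parity)
open import Data.Nat.ListAction using (product) renaming (sum to sumˡ)
import Data.Nat.Properties as ℕ
open import Data.Nat.Combinatorics using (nC1≡n; nCk+nC[k+1]≡[n+1]C[k+1])
open import Data.Parity.Base as ℙ using (0ℙ; 1ℙ) renaming (Parity to 𝔽₂)
import Data.Parity.Properties as ℙ
open import Data.Product.Base using (∃; _×_; _,_; proj₁; proj₂)
open import Data.Sum.Base using (_⊎_; inj₁; inj₂; [_,_]′)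
open import Data.Vec.Base as Vec using ([]; _∷_; _++_; tabulate; here; there)
import Data.Vec.Properties as Vec
open import Function.Base using (_∘_; _$_; id)
open import Function.Bundles using (_⇔_; mk⇔; module Equivalence)
open import Level using (0ℓ)
open import Relation.Binary.PropositionalEquality
  using (_≢_; refl; sym; trans; cong; cong₂; subst; subst₂; module ≡-Reasoning)
open import Relation.Nullary using (¬_; Dec; yes; no; does; ¬?; contradiction)
open import Relation.Nullary.Decidable using (_×-dec_; _⊎-dec_; _→-dec_; does-⇔; decidable-stable)
open import Relation.Unary using (Pred) renaming (Decidable to Decidable₁)

module 𝔽 = SumProperties ℙ.+-0-commutativeMonoid

private variable
  A B : Set
  P Q : Set
  k m n r : ℕ

-- Sums over lists and over words

-- The Iverson bracket.
⟦_⟧ : Dec P → ℕ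
⟦ P? ⟧ = if does P? then 1 else 0

⟦⟧-cong : P ⇔ Q → (P? : Dec P) (Q? : Dec Q) → ⟦ P? ⟧ ≡ ⟦ Q? ⟧
⟦⟧-cong P⇔Q P? Q? = cong (if_then 1 else 0) (does-⇔ P⇔Q P? Q?)

⟦⟧-no : ¬ P → (P? : Dec P) → ⟦ P? ⟧ ≡ 0
⟦⟧-no ¬p (yes p) = contradiction p ¬p
⟦⟧-no ¬p (no _)  = refl

⟦⟧-× : (P? : Dec P) (Q? : Dec Q) → ⟦ P? ×-dec Q? ⟧ ≡ ⟦ P? ⟧ * ⟦ Q? ⟧
⟦⟧-× (yes _) Q? = sym (ℕ.+-identityʳ _)
⟦⟧-× (no _)  Q? = refl

⟦⟧-⊎ : (P → ¬ Q) → (P? : Dec P) (Q? : Dec Q) → ⟦ P? ⊎-dec Q? ⟧ ≡ ⟦ P? ⟧ + ⟦ Q? ⟧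
⟦⟧-⊎ disjoint (yes p) Q? = cong suc (sym (⟦⟧-no (disjoint p) Q?))
⟦⟧-⊎ disjoint (no _)  Q? = refl

-- The sum of f over the entries of a list, counted with repetition.
∑ : List A → (A → ℕ) → ℕ
∑ xs f = sumˡ (List.map f xs)

syntax ∑ xs (λ x → e) = ∑[ x ∈ xs ] e

∑-cong : ∀ (xs : List A) {f g} → (∀ x → f x ≡ g x) → ∑ xs f ≡ ∑ xs g
∑-cong []       f≗g = refl
∑-cong (x ∷ xs) f≗g = cong₂ _+_ (f≗g x) (∑-cong xs f≗g)

∑-zero : ∀ (xs : List A) {f} → (∀ x → f x ≡ 0) → ∑ xs f ≡ 0
∑-zero []       f≗0 = refl
∑-zero (x ∷ xs) f≗0 = cong₂ _+_ (f≗0 x) (∑-zero xs f≗0)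

∑-+ : ∀ (xs : List A) f g → ∑[ x ∈ xs ] (f x + g x) ≡ ∑ xs f + ∑ xs g
∑-+ []       f g = refl
∑-+ (x ∷ xs) f g rewrite ∑-+ xs f g = +-interchange (f x) (g x) (∑ xs f) (∑ xs g)
  where
  open import Algebra.Properties.CommutativeSemigroup ℕ.+-commutativeSemigroup
    using () renaming (interchange to +-interchange)

∑-*ˡ : ∀ (xs : List A) c f → ∑[ x ∈ xs ] (c * f x) ≡ c * ∑ xs f
∑-*ˡ []       c f = sym (ℕ.*-zeroʳ c)
∑-*ˡ (x ∷ xs) c f rewrite ∑-*ˡ xs c f = sym (ℕ.*-distribˡ-+ c (f x) (∑ xs f))

∑-*ʳ : ∀ (xs : List A) c f → ∑[ x ∈ xs ] (f x * c) ≡ ∑ xs f * c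
∑-*ʳ xs c f = begin
  ∑[ x ∈ xs ] (f x * c) ≡⟨ ∑-cong xs (λ x → ℕ.*-comm (f x) c) ⟩
  ∑[ x ∈ xs ] (c * f x) ≡⟨ ∑-*ˡ xs c f ⟩
  c * ∑ xs f            ≡⟨ ℕ.*-comm c _ ⟩
  ∑ xs f * c            ∎
  where open ≡-Reasoning

∑-++ : ∀ (xs ys : List A) f → ∑ (xs List.++ ys) f ≡ ∑ xs f + ∑ ys f
∑-++ []       ys f = refl
∑-++ (x ∷ xs) ys f rewrite ∑-++ xs ys f = sym (ℕ.+-assoc (f x) _ _)

∑-map : ∀ (h : A → B) xs f → ∑ (List.map h xs) f ≡ ∑ xs (f ∘ h)
∑-map h []       f = refl
∑-map h (x ∷ xs) f = cong (f (h x) +_) (∑-map h xs f)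

∑-filter : {P : Pred A 0ℓ} (P? : Decidable₁ P) → ∀ xs f →
           ∑ (filter P? xs) f ≡ ∑[ x ∈ xs ] (⟦ P? x ⟧ * f x)
∑-filter P? []       f = refl
∑-filter P? (x ∷ xs) f with P? x
... | yes _ = cong₂ _+_ (sym (ℕ.+-identityʳ (f x))) (∑-filter P? xs f)
... | no  _ = ∑-filter P? xs f

length-filter : {P : Pred A 0ℓ} (P? : Decidable₁ P) → ∀ xs →
                length (filter P? xs) ≡ ∑[ x ∈ xs ] ⟦ P? x ⟧
length-filter P? []       = refl
length-filter P? (x ∷ xs) with P? x
... | yes _ = cong suc (length-filter P? xs)
... | no  _ = length-filter P? xs

∑-vecs : ∀ (b c : A) n f →
         ∑ (vecs (b ∷ c ∷ []) (suc n)) f ≡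
         ∑[ v ∈ vecs (b ∷ c ∷ []) n ] f (b ∷ v) + ∑[ v ∈ vecs (b ∷ c ∷ []) n ] f (c ∷ v)
∑-vecs b c n f = begin
  ∑ (List.map (b ∷_) vs List.++ List.map (c ∷_) vs List.++ []) f
    ≡⟨ ∑-++ (List.map (b ∷_) vs) _ f ⟩
  ∑ (List.map (b ∷_) vs) f + ∑ (List.map (c ∷_) vs List.++ []) f
    ≡⟨ cong (λ ws → ∑ (List.map (b ∷_) vs) f + ∑ ws f) (++-identityʳ (List.map (c ∷_) vs)) ⟩
  ∑ (List.map (b ∷_) vs) f + ∑ (List.map (c ∷_) vs) f
    ≡⟨ cong₂ _+_ (∑-map (b ∷_) vs f) (∑-map (c ∷_) vs f) ⟩
  ∑ vs (f ∘ (b ∷_)) + ∑ vs (f ∘ (c ∷_)) ∎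
  where
  open ≡-Reasoning
  vs = vecs (b ∷ c ∷ []) n

∑-words : ∀ n f → ∑ (words (suc n)) f ≡ ∑[ x ∈ words n ] f (0ℙ ∷ x) + ∑[ x ∈ words n ] f (1ℙ ∷ x)
∑-words = ∑-vecs 0ℙ 1ℙ

∑-words-++ : ∀ m n f → ∑ (words (m + n)) f ≡ ∑[ x ∈ words m ] ∑[ y ∈ words n ] f (x ++ y)
∑-words-++ zero    n f = sym (ℕ.+-identityʳ _)
∑-words-++ (suc m) n f = begin
  ∑ (words (suc m + n)) f
    ≡⟨ ∑-words (m + n) f ⟩
  ∑[ x ∈ words (m + n) ] f (0ℙ ∷ x) + ∑[ x ∈ words (m + n) ] f (1ℙ ∷ x)
    ≡⟨ cong₂ _+_ (∑-words-++ m n _) (∑-words-++ m n _) ⟩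
  ∑[ x ∈ words m ] ∑[ y ∈ words n ] f (0ℙ ∷ x ++ y) + ∑[ x ∈ words m ] ∑[ y ∈ words n ] f (1ℙ ∷ x ++ y)
    ≡⟨ ∑-words m _ ⟨
  ∑[ x ∈ words (suc m) ] ∑[ y ∈ words n ] f (x ++ y) ∎
  where open ≡-Reasoning

∑-words-concentrated : ∀ (w : Word n) f → (∀ x → x ≢ w → f x ≡ 0) → ∑ (words n) f ≡ f w
∑-words-concentrated []              f f≗0 = ℕ.+-identityʳ _
∑-words-concentrated {suc n} (0ℙ ∷ w) f f≗0
  rewrite ∑-words n f
        | ∑-words-concentrated w (f ∘ (0ℙ ∷_)) (λ x x≢w → f≗0 _ λ { refl → x≢w refl })
        | ∑-zero (words n) {f ∘ (1ℙ ∷_)} (λ x → f≗0 _ λ ())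
  = ℕ.+-identityʳ _
∑-words-concentrated {suc n} (1ℙ ∷ w) f f≗0
  rewrite ∑-words n f
        | ∑-words-concentrated w (f ∘ (1ℙ ∷_)) (λ x x≢w → f≗0 _ λ { refl → x≢w refl })
        | ∑-zero (words n) {f ∘ (0ℙ ∷_)} (λ x → f≗0 _ λ ())
  = refl

-- Supports, weights and finite subsets

-- The Hamming weight.
weight : Word n → ℕ
weight x = ∣ supp x ∣

weight-++ : ∀ (x : Word m) (y : Word n) → weight (x ++ y) ≡ weight x + weight y
weight-++ []       y = refl
weight-++ (0ℙ ∷ x) y = weight-++ x y
weight-++ (1ℙ ∷ x) y = cong suc (weight-++ x y)

-- Pascal's rule, on the first letter of the word.
#weight : ∀ n k → ∑[ x ∈ words n ] ⟦ weight x ℕ.≟ k ⟧ ≡ n C k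
#weight zero    zero    = refl
#weight zero    (suc k) = refl
#weight (suc n) zero    rewrite ∑-words n (λ x → ⟦ weight x ℕ.≟ 0 ⟧) | #weight n 0
  = cong suc (∑-zero (words n) λ _ → refl)
#weight (suc n) (suc k) = begin
  ∑[ x ∈ words (suc n) ] ⟦ weight x ℕ.≟ suc k ⟧ ≡⟨ ∑-words n _ ⟩
  ∑[ x ∈ words n ] ⟦ weight x ℕ.≟ suc k ⟧ + ∑[ x ∈ words n ] ⟦ weight x ℕ.≟ k ⟧
                                                ≡⟨ cong₂ _+_ (#weight n (suc k)) (#weight n k) ⟩
  n C suc k + n C k                             ≡⟨ ℕ.+-comm (n C suc k) _ ⟩
  n C k + n C suc k                             ≡⟨ nCk+nC[k+1]≡[n+1]C[k+1] n k ⟩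
  suc n C suc k                                 ∎
  where open ≡-Reasoning

∈-supp⁺ : ∀ (x : Word n) {u} → lookup x u ≡ 1ℙ → u ∈ supp x
∈-supp⁺ x {u} xᵤ≡1 = Vec.lookup⇒[]= u (supp x) $
  trans (Vec.lookup-map u _ x) (cong (λ b → does (¬? (b ℙ.≟ 0ℙ))) xᵤ≡1)

∈-supp⁻ : ∀ (x : Word n) {u} → u ∈ supp x → lookup x u ≡ 1ℙ
∈-supp⁻ (1ℙ ∷ x) here        = refl
∈-supp⁻ (_ ∷ x)  (there u∈x) = ∈-supp⁻ x u∈x

supp-injective : ∀ {x y : Word n} → supp x ≡ supp y → x ≡ y
supp-injective {x = []}     {[]}     _  = refl
supp-injective {x = 0ℙ ∷ x} {0ℙ ∷ y} eq = cong (0ℙ ∷_) (supp-injective (Vec.∷-injectiveʳ eq))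
supp-injective {x = 1ℙ ∷ x} {1ℙ ∷ y} eq = cong (1ℙ ∷_) (supp-injective (Vec.∷-injectiveʳ eq))

≢𝟎⇒nonempty : ∀ (x : Word n) → x ≢ 𝟎 → Nonempty (supp x)
≢𝟎⇒nonempty []       x≢𝟎 = contradiction refl x≢𝟎
≢𝟎⇒nonempty (1ℙ ∷ x) x≢𝟎 = zero , here
≢𝟎⇒nonempty (0ℙ ∷ x) x≢𝟎 with ≢𝟎⇒nonempty x (x≢𝟎 ∘ cong (0ℙ ∷_))
... | u , u∈x = suc u , there u∈x

∈-supp⇒≢𝟎 : ∀ (x : Word n) {u} → u ∈ supp x → x ≢ 𝟎
∈-supp⇒≢𝟎 x {u} u∈x refl with () ← trans (sym (∈-supp⁻ x u∈x)) (Vec.lookup-replicate u 0ℙ)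

⊆⇒≡⊎⊂ : ∀ {p q : Subset n} → p ⊆ q → p ≡ q ⊎ p ⊂ q
⊆⇒≡⊎⊂ {p = p} {q} p⊆q with any? (λ u → (u ∈? q) ×-dec ¬? (u ∈? p))
... | yes ∃u = inj₂ (p⊆q , ∃u)
... | no  ∄u = inj₁ (⊆-antisym p⊆q λ {u} u∈q →
                 decidable-stable (u ∈? p) λ u∉p → ∄u (u , u∈q , u∉p))

0<∣p∣⇒nonempty : ∀ (p : Subset n) → 0 < ∣ p ∣ → Nonempty p
0<∣p∣⇒nonempty (inside  ∷ p) _ = zero , here
0<∣p∣⇒nonempty (outside ∷ p) 0<∣p∣ with 0<∣p∣⇒nonempty p 0<∣p∣
... | u , u∈p = suc u , there u∈p

∣p∣≤1+∣p-u∣ : ∀ (p : Subset n) u → ∣ p ∣ ≤ suc ∣ p - u ∣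
∣p∣≤1+∣p-u∣ (inside  ∷ p) zero    = s≤s (ℕ.≤-reflexive (cong ∣_∣ (sym (p─⊥≡p p))))
∣p∣≤1+∣p-u∣ (outside ∷ p) zero    = ℕ.m≤n⇒m≤1+n (ℕ.≤-reflexive (cong ∣_∣ (sym (p─⊥≡p p))))
∣p∣≤1+∣p-u∣ (inside  ∷ p) (suc u) = s≤s (∣p∣≤1+∣p-u∣ p u)
∣p∣≤1+∣p-u∣ (outside ∷ p) (suc u) = ∣p∣≤1+∣p-u∣ p u

u∉p-u : ∀ (p : Subset n) u → u ∉ p - u
u∉p-u (_ ∷ p) (suc u) (there u∈) = u∉p-u p u u∈

-- A pigeonhole principle.
∃-fresh : ∀ us (p : Subset n) → length us < ∣ p ∣ → ∃ λ t → t ∈ p × t ∉ˡ us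
∃-fresh []       p 0<∣p∣ with 0<∣p∣⇒nonempty p 0<∣p∣
... | t , t∈p = t , t∈p , λ ()
∃-fresh (u ∷ us) p us<p
  with ∃-fresh us (p - u) (s≤s⁻¹ (ℕ.≤-trans us<p (∣p∣≤1+∣p-u∣ p u)))
... | t , t∈p-u , t∉us = t , p─q⊆p p _ t∈p-u , λ where
  (here refl)  → u∉p-u p u t∈p-u
  (there t∈us) → t∉us t∈us

-- A list of the members of p, as long as p is large.
elements : ∀ (p : Subset n) → ∃ λ us → length us ≡ ∣ p ∣ × (∀ {u} → u ∈ p → u ∈ˡ us)
elements []            = [] , refl , λ ()
elements (outside ∷ p) with elements p
... | us , ∣us∣ , p⊆us = List.map suc us , trans (length-map suc us) ∣us∣ , λ where
  (there u∈p) → ∈-map⁺ suc (p⊆us u∈p)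
elements (inside  ∷ p) with elements p
... | us , ∣us∣ , p⊆us = zero ∷ List.map suc us , cong suc (trans (length-map suc us) ∣us∣) , λ where
  here        → here refl
  (there u∈p) → there (∈-map⁺ suc (p⊆us u∈p))

0<∣p∣ : ∀ {p : Subset n} {u} → u ∈ p → 0 < ∣ p ∣
0<∣p∣ u∈p = ℕ.≤-trans (s≤s z≤n) (x∈p⇒∣p-x∣<∣p∣ u∈p)

∈-++⁺ˡ : ∀ {p : Subset m} {q : Subset n} {u} → u ∈ p → u ↑ˡ n ∈ p ++ q
∈-++⁺ˡ {p = p} {q} {u} u∈p =
  Vec.lookup⇒[]= _ (p ++ q) (trans (Vec.lookup-++ˡ p q u) (Vec.[]=⇒lookup u∈p))

∈-++⁻ˡ : ∀ {p : Subset m} {q : Subset n} {u} → u ↑ˡ n ∈ p ++ q → u ∈ p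
∈-++⁻ˡ {p = p} {q} {u} u∈ =
  Vec.lookup⇒[]= _ p (trans (sym (Vec.lookup-++ˡ p q u)) (Vec.[]=⇒lookup u∈))

∈-++⁺ʳ : ∀ {p : Subset m} {q : Subset n} {u} → u ∈ q → m ↑ʳ u ∈ p ++ q
∈-++⁺ʳ {p = p} {q} {u} u∈q =
  Vec.lookup⇒[]= _ (p ++ q) (trans (Vec.lookup-++ʳ p q u) (Vec.[]=⇒lookup u∈q))

∈-++⁻ʳ : ∀ {p : Subset m} {q : Subset n} {u} → m ↑ʳ u ∈ p ++ q → u ∈ q
∈-++⁻ʳ {p = p} {q} {u} u∈ =
  Vec.lookup⇒[]= _ q (trans (sym (Vec.lookup-++ʳ p q u)) (Vec.[]=⇒lookup u∈))

-- A position in a concatenation lies in its left or in its right part.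
data Position m n : Fin (m + n) → Set where
  left  : ∀ u → Position m n (u ↑ˡ n)
  right : ∀ u → Position m n (m ↑ʳ u)

position : ∀ m {n} (t : Fin (m + n)) → Position m n t
position m {n} t = subst (Position m n) (join-splitAt m n t) (split (splitAt m t))
  where
  split : ∀ s → Position m n (join m n s)
  split (inj₁ u) = left u
  split (inj₂ u) = right u

++-⊆⁺ : ∀ {p p′ : Subset m} {q q′ : Subset n} → p ⊆ p′ → q ⊆ q′ → p ++ q ⊆ p′ ++ q′
++-⊆⁺ {m = m} {p = p} {p′} {q} {q′} p⊆p′ q⊆q′ {t} t∈ with position m t
... | left  u = ∈-++⁺ˡ {p = p′} {q′} (p⊆p′ (∈-++⁻ˡ {p = p} {q} t∈))
... | right u = ∈-++⁺ʳ {p = p′} {q′} (q⊆q′ (∈-++⁻ʳ {p = p} {q} t∈))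

supp-++ : ∀ (x : Word m) (y : Word n) → supp (x ++ y) ≡ supp x ++ supp y
supp-++ = Vec.map-++ _

-- Codewords of a graph code

lookup-linearCombination : ∀ (x : Word m) (rows : Matrix m n) v →
  lookup (linearCombination x rows) v ≡ 𝔽.sum λ u → lookup x u ℙ.* lookup (lookup rows u) v
lookup-linearCombination []       []           v = Vec.lookup-replicate v 0ℙ
lookup-linearCombination (c ∷ cs) (row ∷ rows) v =
  trans (Vec.lookup-zipWith ℙ._+_ v (c · row) (linearCombination cs rows))
        (cong₂ ℙ._+_ (Vec.lookup-map v (c ℙ.*_) row) (lookup-linearCombination cs rows v))

𝟎-++ : ∀ m {n} → 𝟎 {m + n} ≡ 𝟎 {m} ++ 𝟎 {n}
𝟎-++ zero    = refl
𝟎-++ (suc m) = cong (0ℙ ∷_) (𝟎-++ m)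

linearCombination-∥ : ∀ (x : Word m) (R : Matrix m k) (S : Matrix m n) →
  linearCombination x (R ∥ S) ≡ linearCombination x R ++ linearCombination x S
linearCombination-∥ {k = k} [] [] [] = 𝟎-++ k
linearCombination-∥ (c ∷ cs) (r ∷ R) (s ∷ S) = begin
  (c · (r ++ s)) ⊕ linearCombination cs (R ∥ S)
    ≡⟨ cong₂ _⊕_ (Vec.map-++ (c ℙ.*_) r s) (linearCombination-∥ cs R S) ⟩
  ((c · r) ++ (c · s)) ⊕ (linearCombination cs R ++ linearCombination cs S)
    ≡⟨ Vec.zipWith-++ ℙ._+_ (c · r) _ (linearCombination cs R) _ ⟩
  ((c · r) ⊕ linearCombination cs R) ++ ((c · s) ⊕ linearCombination cs S) ∎
  where open ≡-Reasoning

sum-indicator : ∀ (f : Fin n → 𝔽₂) v → 𝔽.sum (λ u → f u ℙ.* indicator (u Fin.≟ v)) ≡ f v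
sum-indicator {suc n} f zero = begin
  f zero ℙ.* 1ℙ ℙ.+ 𝔽.sum (λ u → f (suc u) ℙ.* 0ℙ)
    ≡⟨ cong₂ ℙ._+_ (ℙ.*-identityʳ (f zero)) (𝔽.sum-cong-≗ λ u → ℙ.*-zeroʳ (f (suc u))) ⟩
  f zero ℙ.+ 𝔽.sum {n} (λ _ → 0ℙ)
    ≡⟨ cong (f zero ℙ.+_) (𝔽.sum-replicate-zero n) ⟩
  f zero ℙ.+ 0ℙ
    ≡⟨ ℙ.+-identityʳ _ ⟩
  f zero ∎
  where open ≡-Reasoning
sum-indicator f (suc v) = cong₂ ℙ._+_ (ℙ.*-zeroʳ (f zero)) (sum-indicator (f ∘ suc) v)

lookup-ext : ∀ {x y : Word n} → (∀ v → lookup x v ≡ lookup y v) → x ≡ y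
lookup-ext {x = x} {y} x≗y =
  trans (sym (Vec.tabulate∘lookup x)) (trans (Vec.tabulate-cong x≗y) (Vec.tabulate∘lookup y))

lookup-matrix : ∀ (g : Fin m → Fin n → 𝔽₂) u v →
                lookup (lookup (tabulate λ u → tabulate (g u)) u) v ≡ g u v
lookup-matrix g u v = trans (cong (λ row → lookup row v) (Vec.lookup∘tabulate _ u))
                            (Vec.lookup∘tabulate (g u) v)

linearCombination-identity : ∀ (x : Word n) → linearCombination x (identityMatrix n) ≡ x
linearCombination-identity x = lookup-ext λ v → begin
  lookup (linearCombination x (identityMatrix _)) v
    ≡⟨ lookup-linearCombination x _ v ⟩
  𝔽.sum (λ u → lookup x u ℙ.* lookup (lookup (identityMatrix _) u) v)
    ≡⟨ 𝔽.sum-cong-≗ (λ u → cong (lookup x u ℙ.*_) (lookup-matrix _ u v)) ⟩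
  𝔽.sum (λ u → lookup x u ℙ.* indicator (u Fin.≟ v))
    ≡⟨ sum-indicator (lookup x) v ⟩
  lookup x v ∎
  where open ≡-Reasoning

-- The product x A with the adjacency matrix: at v, the number of vertices in
-- supp x adjacent to v, modulo 2.
neighbourSum : Graph n → Word n → Word n
neighbourSum G x = tabulate λ v → 𝔽.sum λ u → lookup x u ℙ.* indicator (adjacent? u v)
  where open Graph G

-- The codeword with coefficient vector x.
encode : Graph n → Word n → Word (n + n)
encode G x = x ++ neighbourSum G x

linearCombination-generator : ∀ (G : Graph n) x →
  linearCombination x (generatorMatrix G) ≡ encode G x
linearCombination-generator {n} G x = begin
  linearCombination x (generatorMatrix G)
    ≡⟨ linearCombination-∥ x (identityMatrix n) (adjacencyMatrix G) ⟩
  linearCombination x (identityMatrix n) ++ linearCombination x (adjacencyMatrix G)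
    ≡⟨ cong₂ _++_ (linearCombination-identity x) (lookup-ext adjacencyHalf) ⟩
  encode G x ∎
  where
  open ≡-Reasoning
  open Graph G
  adjacencyHalf : ∀ v → lookup (linearCombination x (adjacencyMatrix G)) v ≡ lookup (neighbourSum G x) v
  adjacencyHalf v = begin
    lookup (linearCombination x (adjacencyMatrix G)) v
      ≡⟨ lookup-linearCombination x (adjacencyMatrix G) v ⟩
    𝔽.sum (λ u → lookup x u ℙ.* lookup (lookup (adjacencyMatrix G) u) v)
      ≡⟨ 𝔽.sum-cong-≗ (λ u → cong (lookup x u ℙ.*_) (lookup-matrix _ u v)) ⟩
    𝔽.sum (λ u → lookup x u ℙ.* indicator (adjacent? u v))
      ≡⟨ Vec.lookup∘tabulate _ v ⟨
    lookup (neighbourSum G x) v ∎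

encode-∈ : ∀ (G : Graph n) x → graphCode G (encode G x)
encode-∈ G x = x , sym (linearCombination-generator G x)

∈-graphCode⁻ : ∀ (G : Graph n) {w} → graphCode G w → ∃ λ x → w ≡ encode G x
∈-graphCode⁻ G (x , w≡) = x , trans w≡ (linearCombination-generator G x)

minimal? : ∀ (G : Graph n) → Decidable₁ (IsMinimal (graphCode G))
minimal? G = isMinimal? (generatedBy? (generatorMatrix G))

-- A word of length 2n is determined by its left half if it is a codeword, so
-- minimal codewords may be counted by their coefficient vectors.
M≡∑-encode : ∀ (G : Graph n) → M G ≡ ∑[ x ∈ words n ] ⟦ minimal? G (encode G x) ⟧
M≡∑-encode {n} G = begin
  M G
    ≡⟨ length-filter (minimal? G) (words (n + n)) ⟩
  ∑[ w ∈ words (n + n) ] ⟦ minimal? G w ⟧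
    ≡⟨ ∑-words-++ n n _ ⟩
  ∑[ x ∈ words n ] ∑[ y ∈ words n ] ⟦ minimal? G (x ++ y) ⟧
    ≡⟨ ∑-cong (words n) (λ x → ∑-words-concentrated (neighbourSum G x) _ (notInCode x)) ⟩
  ∑[ x ∈ words n ] ⟦ minimal? G (encode G x) ⟧ ∎
  where
  open ≡-Reasoning
  notInCode : ∀ x y → y ≢ neighbourSum G x → ⟦ minimal? G (x ++ y) ⟧ ≡ 0
  notInCode x y y≢ = ⟦⟧-no notMinimal (minimal? G (x ++ y))
    where
    notMinimal : ¬ IsMinimal (graphCode G) (x ++ y)
    notMinimal (xy∈C , _) with ∈-graphCode⁻ G xy∈C
    ... | x′ , xy≡ with refl ← Vec.++-injectiveˡ x x′ xy≡ = y≢ (Vec.++-injectiveʳ x x′ xy≡)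

-- The codeword of y witnesses that the codeword of x is not minimal.  Proper
-- inclusion is asked of the left halves only; encode-⊂⁻ shows that this loses
-- nothing.
Dominated : Graph n → Word n → Word n → Set
Dominated G y x = y ≢ 𝟎 × supp y ⊂ supp x × supp (neighbourSum G y) ⊆ supp (neighbourSum G x)

encode-≢𝟎⁺ : ∀ (G : Graph n) {x} → x ≢ 𝟎 → encode G x ≢ 𝟎
encode-≢𝟎⁺ {n} G {x} x≢𝟎 eq = x≢𝟎 (Vec.++-injectiveˡ x 𝟎 (trans eq (𝟎-++ n)))

encode-≢𝟎⁻ : ∀ (G : Graph n) {x} → encode G x ≢ 𝟎 → x ≢ 𝟎
encode-≢𝟎⁻ {n} G cx≢𝟎 refl = cx≢𝟎 (trans (cong (𝟎 {n} ++_) (lookup-ext λ v → begin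
  lookup (neighbourSum G 𝟎) v
    ≡⟨ Vec.lookup∘tabulate _ v ⟩
  𝔽.sum (λ u → lookup (𝟎 {n}) u ℙ.* indicator (adjacent? u v))
    ≡⟨ 𝔽.sum-cong-≗ (λ u → cong (ℙ._* indicator (adjacent? u v)) (Vec.lookup-replicate u 0ℙ)) ⟩
  𝔽.sum {n} (λ u → 0ℙ)
    ≡⟨ 𝔽.sum-replicate-zero n ⟩
  0ℙ
    ≡⟨ Vec.lookup-replicate v 0ℙ ⟨
  lookup (𝟎 {n}) v ∎)) (sym (𝟎-++ n)))
  where
  open ≡-Reasoning
  open Graph G

encode-⊂⁺ : ∀ (G : Graph n) {x y} → supp y ⊂ supp x → supp (neighbourSum G y) ⊆ supp (neighbourSum G x) →
            supp (encode G y) ⊂ supp (encode G x)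
encode-⊂⁺ G {x} {y} (y⊆x , u , u∈x , u∉y) Ny⊆Nx
  rewrite supp-++ x (neighbourSum G x) | supp-++ y (neighbourSum G y)
  = ++-⊆⁺ y⊆x Ny⊆Nx , u ↑ˡ _ , ∈-++⁺ˡ u∈x , u∉y ∘ ∈-++⁻ˡ

encode-⊂⁻ : ∀ (G : Graph n) {x y} → supp (encode G y) ⊂ supp (encode G x) →
            supp y ⊂ supp x × supp (neighbourSum G y) ⊆ supp (neighbourSum G x)
encode-⊂⁻ {n} G {x} {y} cy⊂cx = y⊂x , λ u∈Ny → ∈-++⁻ʳ (Sy⊆Sx (∈-++⁺ʳ u∈Ny))
  where
  Sy⊆Sx : supp y ++ supp (neighbourSum G y) ⊆ supp x ++ supp (neighbourSum G x)
  Sy⊆Sx rewrite sym (supp-++ x (neighbourSum G x)) | sym (supp-++ y (neighbourSum G y)) = proj₁ cy⊂cx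
  y⊂x : supp y ⊂ supp x
  y⊂x with ⊆⇒≡⊎⊂ {p = supp y} {supp x} (λ u∈y → ∈-++⁻ˡ (Sy⊆Sx (∈-++⁺ˡ u∈y)))
  ... | inj₁ eq with refl ← supp-injective {x = y} {x} eq = ⊥-elim (⊂-irref refl cy⊂cx)
  ... | inj₂ y⊂x = y⊂x

minimal⇔ : ∀ (G : Graph n) x →
           IsMinimal (graphCode G) (encode G x) ⇔ (x ≢ 𝟎 × (∀ y → ¬ Dominated G y x))
minimal⇔ G x = mk⇔ to from
  where
  to : IsMinimal (graphCode G) (encode G x) → x ≢ 𝟎 × (∀ y → ¬ Dominated G y x)
  to (_ , cx≢𝟎 , min) = encode-≢𝟎⁻ G cx≢𝟎 , λ y (y≢𝟎 , y⊂x , Ny⊆Nx) →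
    min (encode G y , encode-∈ G y , encode-≢𝟎⁺ G y≢𝟎 , encode-⊂⁺ G y⊂x Ny⊆Nx)
  from : x ≢ 𝟎 × (∀ y → ¬ Dominated G y x) → IsMinimal (graphCode G) (encode G x)
  from (x≢𝟎 , undominated) = encode-∈ G x , encode-≢𝟎⁺ G x≢𝟎 , none
    where
    none : ¬ (∃ λ c → graphCode G c × c ≢ 𝟎 × supp c ⊂ supp (encode G x))
    none (c , c∈C , c≢𝟎 , c⊂) with ∈-graphCode⁻ G c∈C
    ... | y , refl = undominated y (encode-≢𝟎⁻ G c≢𝟎 , encode-⊂⁻ G c⊂)

-- Words of weight two, parities and transversals

indicator-yes : P → (P? : Dec P) → indicator P? ≡ 1ℙ
indicator-yes p (yes _) = refl
indicator-yes p (no ¬p) = contradiction p ¬p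

indicator-no : ¬ P → (P? : Dec P) → indicator P? ≡ 0ℙ
indicator-no ¬p (yes p) = contradiction p ¬p
indicator-no ¬p (no _)  = refl

-- For u ≢ w, the word with support u, w; it is zero if u ≡ w.
pair : Fin n → Fin n → Word n
pair u w = tabulate λ t → indicator (t Fin.≟ u) ℙ.+ indicator (t Fin.≟ w)

∈-pair⁻ : ∀ (u w : Fin n) {t} → t ∈ supp (pair u w) → t ≡ u ⊎ t ≡ w
∈-pair⁻ u w {t} t∈ with ∈-supp⁻ (pair u w) t∈
... | pₜ≡1 rewrite Vec.lookup∘tabulate (λ t → indicator (t Fin.≟ u) ℙ.+ indicator (t Fin.≟ w)) t
  with t Fin.≟ u | t Fin.≟ w
... | yes t≡u | _       = inj₁ t≡u
... | no _    | yes t≡w = inj₂ t≡w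

∈-pair⁺ : ∀ {u w : Fin n} → u ≢ w → u ∈ supp (pair u w)
∈-pair⁺ {u = u} {w} u≢w = ∈-supp⁺ (pair u w) (trans (Vec.lookup∘tabulate _ u)
  (cong₂ ℙ._+_ (indicator-yes refl (u Fin.≟ u)) (indicator-no u≢w (u Fin.≟ w))))

neighbourSum-pair : ∀ (G : Graph n) u w v → let open Graph G in
  lookup (neighbourSum G (pair u w)) v ≡ indicator (adjacent? u v) ℙ.+ indicator (adjacent? w v)
neighbourSum-pair G u w v = begin
  lookup (neighbourSum G (pair u w)) v
    ≡⟨ Vec.lookup∘tabulate _ v ⟩
  𝔽.sum (λ t → lookup (pair u w) t ℙ.* adj t)
    ≡⟨ 𝔽.sum-cong-≗ expand ⟩
  𝔽.sum (λ t → adj t ℙ.* indicator (t Fin.≟ u) ℙ.+ (adj t ℙ.* indicator (t Fin.≟ w)))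
    ≡⟨ 𝔽.∑-distrib-+ (λ t → adj t ℙ.* indicator (t Fin.≟ u)) _ ⟩
  𝔽.sum (λ t → adj t ℙ.* indicator (t Fin.≟ u)) ℙ.+ 𝔽.sum (λ t → adj t ℙ.* indicator (t Fin.≟ w))
    ≡⟨ cong₂ ℙ._+_ (sum-indicator adj u) (sum-indicator adj w) ⟩
  adj u ℙ.+ adj w ∎
  where
  open ≡-Reasoning
  open Graph G
  adj = λ t → indicator (adjacent? t v)
  expand : ∀ t → lookup (pair u w) t ℙ.* adj t ≡
                 adj t ℙ.* indicator (t Fin.≟ u) ℙ.+ (adj t ℙ.* indicator (t Fin.≟ w))
  expand t = begin
    lookup (pair u w) t ℙ.* adj t
      ≡⟨ ℙ.*-comm (lookup (pair u w) t) (adj t) ⟩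
    adj t ℙ.* lookup (pair u w) t
      ≡⟨ cong (adj t ℙ.*_) (Vec.lookup∘tabulate _ t) ⟩
    adj t ℙ.* (indicator (t Fin.≟ u) ℙ.+ indicator (t Fin.≟ w))
      ≡⟨ ℙ.*-distribˡ-+ (adj t) (indicator (t Fin.≟ u)) (indicator (t Fin.≟ w)) ⟩
    adj t ℙ.* indicator (t Fin.≟ u) ℙ.+ (adj t ℙ.* indicator (t Fin.≟ w)) ∎

parity-suc : ∀ n → parity (suc n) ≡ parity n ℙ.⁻¹
parity-suc n = trans (sym (ℙ.⁻¹-involutive _)) (cong ℙ._⁻¹ (ℙ.suc-homo-⁻¹ n))

sum-parity : ∀ (x : Word n) → 𝔽.sum (lookup x) ≡ parity (weight x)
sum-parity []       = refl
sum-parity (0ℙ ∷ x) = sum-parity x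
sum-parity (1ℙ ∷ x) = trans (cong ℙ._⁻¹ (sum-parity x)) (sym (parity-suc (weight x)))

-- The support of x has at most one vertex in each class.
Transversal : (Fin n → Fin r) → Pred (Word n) 0ℓ
Transversal cls x = ∀ u w → u ∈ supp x → w ∈ supp x → cls u ≡ cls w → u ≡ w

transversal? : ∀ (cls : Fin n → Fin r) → Decidable₁ (Transversal cls)
transversal? cls x = all? λ u → all? λ w →
  (u ∈? supp x) →-dec (w ∈? supp x) →-dec (cls u Fin.≟ cls w) →-dec (u Fin.≟ w)

∃-missedClass : ∀ (cls : Fin n → Fin r) → (∀ i → ∃ λ v → cls v ≡ i) → ∀ (p : Subset n) → ∣ p ∣ < r →
                ∃ λ v → ∀ {u} → u ∈ p → cls u ≢ cls v
∃-missedClass {r = r} cls cls-onto p ∣p∣<r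
  with us , ∣us∣ , p⊆us ← elements p
  with i , _ , i∉ ← ∃-fresh (List.map cls us) (full {r})
                      (subst₂ _<_ (sym (trans (length-map cls us) ∣us∣)) (sym (∣⊤∣≡n r)) ∣p∣<r)
  with v , refl ← cls-onto i
  = v , λ u∈p cᵤ≡cᵥ → i∉ (subst (_∈ˡ List.map cls us) cᵤ≡cᵥ (∈-map⁺ cls (p⊆us u∈p)))

parity≡1⇒%2≡1 : ∀ m → parity m ≡ 1ℙ → m % 2 ≡ 1
parity≡1⇒%2≡1 1             _   = refl
parity≡1⇒%2≡1 (suc (suc m)) odd = parity≡1⇒%2≡1 m odd

%2≡1⇒parity≡1 : ∀ m → m % 2 ≡ 1 → parity m ≡ 1ℙ
%2≡1⇒parity≡1 1             _   = refl
%2≡1⇒parity≡1 (suc (suc m)) odd = %2≡1⇒parity≡1 m odd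

-- Minimal codewords of a complete multipartite graph

module Multipartite (a : Vec ℕ r) where

  G : Graph (sum a)
  G = completeMultipartite a

  open Graph G using (adjacent?)

  cls : Fin (sum a) → Fin r
  cls = classOf a

  -- The right half of a codeword, as a function of the vertex.
  N : Word (sum a) → Fin (sum a) → 𝔽₂
  N x = lookup (neighbourSum G x)

  -- A vertex whose class is missed by x is adjacent to all vertices of x.
  N≡parity : ∀ x v → (∀ {u} → u ∈ supp x → cls u ≢ cls v) → N x v ≡ parity (weight x)
  N≡parity x v missed = begin
    N x v
      ≡⟨ Vec.lookup∘tabulate _ v ⟩
    𝔽.sum (λ u → lookup x u ℙ.* indicator (adjacent? u v))
      ≡⟨ 𝔽.sum-cong-≗ term ⟩
    𝔽.sum (lookup x)
      ≡⟨ sum-parity x ⟩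
    parity (weight x) ∎
    where
    open ≡-Reasoning
    term : ∀ u → lookup x u ℙ.* indicator (adjacent? u v) ≡ lookup x u
    term u with lookup x u in xᵤ≡
    ... | 0ℙ = refl
    ... | 1ℙ = indicator-yes (missed (∈-supp⁺ x xᵤ≡)) (adjacent? u v)

  -- If u₀ is the only vertex of x in the class of v, then v is adjacent to all
  -- vertices of x but u₀.
  N≡parity⁻¹ : ∀ x v {u₀} → u₀ ∈ supp x → cls u₀ ≡ cls v →
               (∀ {u} → u ∈ supp x → cls u ≡ cls v → u ≡ u₀) → N x v ≡ parity (weight x) ℙ.⁻¹
  N≡parity⁻¹ x v {u₀} u₀∈x c≡c unique = begin
    N x v
      ≡⟨ Vec.lookup∘tabulate _ v ⟩
    𝔽.sum (λ u → lookup x u ℙ.* indicator (adjacent? u v))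
      ≡⟨ 𝔽.sum-cong-≗ term ⟩
    𝔽.sum (λ u → 1ℙ ℙ.* indicator (u Fin.≟ u₀) ℙ.+ lookup x u)
      ≡⟨ 𝔽.∑-distrib-+ (λ u → 1ℙ ℙ.* indicator (u Fin.≟ u₀)) _ ⟩
    𝔽.sum (λ u → 1ℙ ℙ.* indicator (u Fin.≟ u₀)) ℙ.+ 𝔽.sum (lookup x)
      ≡⟨ cong₂ ℙ._+_ (sum-indicator (λ _ → 1ℙ) u₀) (sum-parity x) ⟩
    parity (weight x) ℙ.⁻¹ ∎
    where
    open ≡-Reasoning
    -- At u₀ both sides vanish, as 1 + 1 = 0.
    term : ∀ u → lookup x u ℙ.* indicator (adjacent? u v) ≡ indicator (u Fin.≟ u₀) ℙ.+ lookup x u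
    term u with u Fin.≟ u₀
    ... | yes refl rewrite ∈-supp⁻ x u₀∈x = indicator-no (λ c≢c → c≢c c≡c) (adjacent? u v)
    ... | no u≢u₀ with lookup x u in xᵤ≡
    ...   | 0ℙ = refl
    ...   | 1ℙ = indicator-yes (λ cᵤ≡ → u≢u₀ (unique (∈-supp⁺ x xᵤ≡) cᵤ≡)) (adjacent? u v)

  separates : ∀ {x y v} → Dominated G y x → N y v ≡ 1ℙ → N x v ≡ 0ℙ → ⊥
  separates {x} {y} {v} (_ , _ , Ny⊆Nx) Ny≡1 Nx≡0
    with () ← trans (sym Nx≡0) (∈-supp⁻ (neighbourSum G x) (Ny⊆Nx (∈-supp⁺ (neighbourSum G y) Ny≡1)))

  undominated-≤2 : 3 ≤ r → (∀ i → ∃ λ v → cls v ≡ i) →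
                   ∀ x y → weight x ≤ 2 → ¬ Dominated G y x
  undominated-≤2 3≤r cls-onto x y ∣x∣≤2 dom@(y≢𝟎 , y⊂x , _)
    with v , missed ← ∃-missedClass cls cls-onto (supp x) (ℕ.≤-trans (s≤s ∣x∣≤2) 3≤r)
    = separates dom
        (trans (N≡parity y v (missed ∘ proj₁ y⊂x)) (cong parity ∣y∣≡1))
        (trans (N≡parity x v missed) (cong parity ∣x∣≡2))
    where
    1≤∣y∣ = 0<∣p∣ (proj₂ (≢𝟎⇒nonempty y y≢𝟎))
    ∣y∣<∣x∣ = p⊂q⇒∣p∣<∣q∣ y⊂x
    ∣y∣≡1 : weight y ≡ 1
    ∣y∣≡1 = ℕ.≤-antisym (s≤s⁻¹ (ℕ.≤-trans ∣y∣<∣x∣ ∣x∣≤2)) 1≤∣y∣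
    ∣x∣≡2 : weight x ≡ 2
    ∣x∣≡2 = ℕ.≤-antisym ∣x∣≤2 (ℕ.≤-trans (s≤s 1≤∣y∣) ∣y∣<∣x∣)

  undominated-odd : ∀ x y → Transversal cls x → parity (weight x) ≡ 1ℙ → ¬ Dominated G y x
  undominated-odd x y trans-x odd-x dom@(y≢𝟎 , (y⊆x , v , v∈x , v∉y) , _)
    with parity (weight y) in parity-y
  -- N y and N x differ at v, a vertex of x outside y.
  ... | 1ℙ = separates dom
        (trans (N≡parity y v λ {u} u∈y cᵤ≡cᵥ → v∉y (subst (_∈ supp y) (trans-x u v (y⊆x u∈y) v∈x cᵤ≡cᵥ) u∈y))
               parity-y)
        (trans (N≡parity⁻¹ x v v∈x refl λ {u} u∈x → trans-x u v u∈x v∈x) (cong ℙ._⁻¹ odd-x))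
  -- N y and N x differ at w, a vertex of y.
  ... | 0ℙ with w , w∈y ← ≢𝟎⇒nonempty y y≢𝟎 = separates dom
        (trans (N≡parity⁻¹ y w w∈y refl λ {u} u∈y → trans-x u w (y⊆x u∈y) (y⊆x w∈y)) (cong ℙ._⁻¹ parity-y))
        (trans (N≡parity⁻¹ x w (y⊆x w∈y) refl λ {u} u∈x → trans-x u w u∈x (y⊆x w∈y)) (cong ℙ._⁻¹ odd-x))

  -- When x has weight at least 3, the inclusion of the left halves is proper.
  pair-dominated : ∀ x {u w} → 3 ≤ weight x → u ∈ supp x → w ∈ supp x → u ≢ w →
                   supp (neighbourSum G (pair u w)) ⊆ supp (neighbourSum G x) → Dominated G (pair u w) x
  pair-dominated x {u} {w} 3≤∣x∣ u∈x w∈x u≢w N⊆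
    with t , t∈x , t∉uw ← ∃-fresh (u ∷ w ∷ []) (supp x) 3≤∣x∣
    = ∈-supp⇒≢𝟎 (pair u w) (∈-pair⁺ u≢w)
    , ((λ s∈ → [ (λ { refl → u∈x }) , (λ { refl → w∈x }) ]′ (∈-pair⁻ u w s∈))
      , t , t∈x , λ t∈ → t∉uw ([ here , (λ t≡w → there (here t≡w)) ]′ (∈-pair⁻ u w t∈)))
    , N⊆

  sameClass-dominated : ∀ x {u w} → 3 ≤ weight x → u ∈ supp x → w ∈ supp x → u ≢ w → cls u ≡ cls w →
                        Dominated G (pair u w) x
  sameClass-dominated x {u} {w} 3≤∣x∣ u∈x w∈x u≢w cᵤ≡c = pair-dominated x 3≤∣x∣ u∈x w∈x u≢w N⊆
    where
    N≡0 : ∀ v → N (pair u w) v ≡ 0ℙ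
    N≡0 v rewrite neighbourSum-pair G u w v | cᵤ≡c = ℙ.p+p≡0ℙ (indicator (adjacent? w v))
    N⊆ : supp (neighbourSum G (pair u w)) ⊆ supp (neighbourSum G x)
    N⊆ {v} v∈ with () ← trans (sym (∈-supp⁻ (neighbourSum G (pair u w)) v∈)) (N≡0 v)

  even-dominated : ∀ x {u w} → 3 ≤ weight x → u ∈ supp x → w ∈ supp x → u ≢ w →
                   Transversal cls x → parity (weight x) ≡ 0ℙ → Dominated G (pair u w) x
  even-dominated x {u} {w} 3≤∣x∣ u∈x w∈x u≢w trans-x even-x = pair-dominated x 3≤∣x∣ u∈x w∈x u≢w N⊆
    where
    -- N x is 1 on every class met by x.
    hit : ∀ {s v} → s ∈ supp x → cls s ≡ cls v → v ∈ supp (neighbourSum G x)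
    hit {s} {v} s∈x cₛ≡cᵥ = ∈-supp⁺ (neighbourSum G x) (trans
      (N≡parity⁻¹ x v s∈x cₛ≡cᵥ λ {t} t∈x cₜ≡cᵥ → trans-x t s t∈x s∈x (trans cₜ≡cᵥ (sym cₛ≡cᵥ)))
      (cong ℙ._⁻¹ even-x))
    N⊆ : supp (neighbourSum G (pair u w)) ⊆ supp (neighbourSum G x)
    -- Where v lies in neither class, N (pair u w) v is 1 + 1 = 0.
    N⊆ {v} v∈ with cls u Fin.≟ cls v | cls w Fin.≟ cls v
    ... | yes cᵤ≡cᵥ | _         = hit u∈x cᵤ≡cᵥ
    ... | no _      | yes c≡cᵥ = hit w∈x c≡cᵥ
    ... | no cᵤ≢cᵥ  | no c≢cᵥ
      with () ← trans (sym (∈-supp⁻ (neighbourSum G (pair u w)) v∈)) (trans (neighbourSum-pair G u w v)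
                  (cong₂ ℙ._+_ (indicator-yes cᵤ≢cᵥ (adjacent? u v)) (indicator-yes c≢cᵥ (adjacent? w v))))

  minimal⇔shape : 3 ≤ r → (∀ i → ∃ λ v → cls v ≡ i) → ∀ x →
    IsMinimal (graphCode G) (encode G x) ⇔
    ((weight x ≡ 1 ⊎ weight x ≡ 2) ⊎ (Transversal cls x × weight x % 2 ≡ 1 × 3 ≤ weight x))
  minimal⇔shape 3≤r cls-onto x = mk⇔
    (λ min → to (Equivalence.to (minimal⇔ G x) min))
    (λ shape → Equivalence.from (minimal⇔ G x) (from shape))
    where
    Shape = (weight x ≡ 1 ⊎ weight x ≡ 2) ⊎ (Transversal cls x × weight x % 2 ≡ 1 × 3 ≤ weight x)

    positive : 0 < weight x → x ≢ 𝟎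
    positive 0<∣x∣ = ∈-supp⇒≢𝟎 x (proj₂ (0<∣p∣⇒nonempty (supp x) 0<∣x∣))

    from : Shape → x ≢ 𝟎 × (∀ y → ¬ Dominated G y x)
    from (inj₁ (inj₁ ∣x∣≡1)) =
      positive (ℕ.≤-reflexive (sym ∣x∣≡1)) ,
      λ y → undominated-≤2 3≤r cls-onto x y (ℕ.≤-trans (ℕ.≤-reflexive ∣x∣≡1) (s≤s z≤n))
    from (inj₁ (inj₂ ∣x∣≡2)) =
      positive (ℕ.≤-trans (s≤s z≤n) (ℕ.≤-reflexive (sym ∣x∣≡2))) ,
      λ y → undominated-≤2 3≤r cls-onto x y (ℕ.≤-reflexive ∣x∣≡2)
    from (inj₂ (trans-x , odd-x , 3≤∣x∣)) =
      positive (ℕ.≤-trans (s≤s z≤n) 3≤∣x∣) ,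
      λ y → undominated-odd x y trans-x (%2≡1⇒parity≡1 (weight x) odd-x)

    large : 3 ≤ weight x → (∀ y → ¬ Dominated G y x) → Transversal cls x × weight x % 2 ≡ 1 × 3 ≤ weight x
    large 3≤∣x∣ undominated = trans-x , parity≡1⇒%2≡1 (weight x) odd-x , 3≤∣x∣
      where
      trans-x : Transversal cls x
      trans-x u w u∈x w∈x cᵤ≡c = decidable-stable (u Fin.≟ w) λ u≢w →
        undominated (pair u w) (sameClass-dominated x 3≤∣x∣ u∈x w∈x u≢w cᵤ≡c)
      odd-x : parity (weight x) ≡ 1ℙ
      odd-x with parity (weight x) in parity-x
      ... | 1ℙ = refl
      ... | 0ℙ
        with u , u∈x , _ ← ∃-fresh [] (supp x) (ℕ.≤-trans (s≤s z≤n) 3≤∣x∣)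
        with w , w∈x , w∉u ← ∃-fresh (u ∷ []) (supp x) (ℕ.≤-trans (s≤s (s≤s z≤n)) 3≤∣x∣)
        = contradiction (even-dominated x 3≤∣x∣ u∈x w∈x (λ { refl → w∉u (here refl) }) trans-x parity-x)
                        (undominated (pair u w))

    to : x ≢ 𝟎 × (∀ y → ¬ Dominated G y x) → Shape
    to (x≢𝟎 , undominated) with weight x ℕ.≟ 1 | weight x ℕ.≟ 2
    ... | yes ∣x∣≡1 | _         = inj₁ (inj₁ ∣x∣≡1)
    ... | no _      | yes ∣x∣≡2 = inj₁ (inj₂ ∣x∣≡2)
    ... | no ∣x∣≢1  | no ∣x∣≢2  = inj₂ (large
      (ℕ.≤∧≢⇒< (ℕ.≤∧≢⇒< (0<∣p∣ (proj₂ (≢𝟎⇒nonempty x x≢𝟎))) (∣x∣≢1 ∘ sym)) (∣x∣≢2 ∘ sym))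
      undominated)

-- Counting transversal words

classOf-↑ˡ : ∀ k (a : Vec ℕ r) u → classOf (k ∷ a) (u ↑ˡ sum a) ≡ zero
classOf-↑ˡ k a u rewrite splitAt-↑ˡ k u (sum a) = refl

classOf-↑ʳ : ∀ k (a : Vec ℕ r) v → classOf (k ∷ a) (k ↑ʳ v) ≡ suc (classOf a v)
classOf-↑ʳ k a v rewrite splitAt-↑ʳ k (sum a) v = refl

classOf-onto : ∀ (a : Vec ℕ r) → (∀ i → 1 ≤ lookup a i) → ∀ i → ∃ λ v → classOf a v ≡ i
classOf-onto (zero ∷ a)  1≤a zero    = contradiction (1≤a zero) λ ()
classOf-onto (suc k ∷ a) 1≤a zero    = zero , refl
classOf-onto (k ∷ a)     1≤a (suc i) with v , refl ← classOf-onto a (1≤a ∘ suc) i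
  = k ↑ʳ v , classOf-↑ʳ k a v

weight≤1⇔ : ∀ (x : Word n) → (weight x ≡ 0 ⊎ weight x ≡ 1) ⇔ (∀ u w → u ∈ supp x → w ∈ supp x → u ≡ w)
weight≤1⇔ x = mk⇔ to from
  where
  to : weight x ≡ 0 ⊎ weight x ≡ 1 → ∀ u w → u ∈ supp x → w ∈ supp x → u ≡ w
  to (inj₁ ∣x∣≡0) u w u∈x w∈x = contradiction (sym ∣x∣≡0) (ℕ.<⇒≢ (0<∣p∣ u∈x))
  to (inj₂ ∣x∣≡1) u w u∈x w∈x with elements (supp x)
  ... | us , ∣us∣ , x⊆us = unique us (trans ∣us∣ ∣x∣≡1) (x⊆us u∈x) (x⊆us w∈x)
    where
    unique : ∀ us → length us ≡ 1 → u ∈ˡ us → w ∈ˡ us → u ≡ w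
    unique (_ ∷ []) _ (here refl) (here refl) = refl
  from : (∀ u w → u ∈ supp x → w ∈ supp x → u ≡ w) → weight x ≡ 0 ⊎ weight x ≡ 1
  from atMost1 with weight x ℕ.≟ 0 | weight x ℕ.≟ 1
  ... | yes ∣x∣≡0 | _         = inj₁ ∣x∣≡0
  ... | no _      | yes ∣x∣≡1 = inj₂ ∣x∣≡1
  ... | no ∣x∣≢0  | no ∣x∣≢1
    with u , u∈x , _   ← ∃-fresh [] (supp x) (ℕ.n≢0⇒n>0 ∣x∣≢0)
    with w , w∈x , w∉u ← ∃-fresh (u ∷ []) (supp x) (ℕ.≤∧≢⇒< (ℕ.n≢0⇒n>0 ∣x∣≢0) (∣x∣≢1 ∘ sym))
    = contradiction (here (atMost1 w u w∈x u∈x)) w∉u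

-- The vertices of the first class carry x, those of the other classes carry y.
transversal-++⇔ : ∀ k (a : Vec ℕ r) (x : Word k) y →
  Transversal (classOf (k ∷ a)) (x ++ y) ⇔ ((weight x ≡ 0 ⊎ weight x ≡ 1) × Transversal (classOf a) y)
transversal-++⇔ k a x y = mk⇔
  (λ T → Equivalence.from (weight≤1⇔ x) (onLeft T) , onRight T)
  (λ (≤1 , T) → glue (Equivalence.to (weight≤1⇔ x) ≤1) T)
  where
  xy≡ = supp-++ x y

  ∈ˡ⁺ : ∀ {u} → u ∈ supp x → u ↑ˡ sum a ∈ supp (x ++ y)
  ∈ˡ⁺ u∈x = subst (_ ∈_) (sym xy≡) (∈-++⁺ˡ u∈x)
  ∈ʳ⁺ : ∀ {u} → u ∈ supp y → k ↑ʳ u ∈ supp (x ++ y)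
  ∈ʳ⁺ u∈y = subst (_ ∈_) (sym xy≡) (∈-++⁺ʳ u∈y)
  ∈ˡ⁻ : ∀ {u} → u ↑ˡ sum a ∈ supp (x ++ y) → u ∈ supp x
  ∈ˡ⁻ u∈ = ∈-++⁻ˡ (subst (_ ∈_) xy≡ u∈)
  ∈ʳ⁻ : ∀ {u} → k ↑ʳ u ∈ supp (x ++ y) → u ∈ supp y
  ∈ʳ⁻ u∈ = ∈-++⁻ʳ (subst (_ ∈_) xy≡ u∈)

  onLeft : Transversal (classOf (k ∷ a)) (x ++ y) → ∀ u w → u ∈ supp x → w ∈ supp x → u ≡ w
  onLeft T u w u∈x w∈x = Fin.↑ˡ-injective (sum a) u w
    (T _ _ (∈ˡ⁺ u∈x) (∈ˡ⁺ w∈x) (trans (classOf-↑ˡ k a u) (sym (classOf-↑ˡ k a w))))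

  onRight : Transversal (classOf (k ∷ a)) (x ++ y) → Transversal (classOf a) y
  onRight T u w u∈y w∈y cᵤ≡c = Fin.↑ʳ-injective k u w
    (T _ _ (∈ʳ⁺ u∈y) (∈ʳ⁺ w∈y) (trans (classOf-↑ʳ k a u) (trans (cong suc cᵤ≡c) (sym (classOf-↑ʳ k a w)))))

  glue : (∀ u w → u ∈ supp x → w ∈ supp x → u ≡ w) → Transversal (classOf a) y →
         Transversal (classOf (k ∷ a)) (x ++ y)
  glue ≤1 T s t s∈ t∈ cₛ≡cₜ with position k s | position k t
  ... | left u  | left w  = cong (_↑ˡ sum a) (≤1 u w (∈ˡ⁻ s∈) (∈ˡ⁻ t∈))
  ... | right u | right w = cong (k ↑ʳ_) (T u w (∈ʳ⁻ s∈) (∈ʳ⁻ t∈)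
        (Fin.suc-injective (trans (sym (classOf-↑ʳ k a u)) (trans cₛ≡cₜ (classOf-↑ʳ k a w)))))
  ... | left u  | right w with () ← trans (sym (classOf-↑ˡ k a u)) (trans cₛ≡cₜ (classOf-↑ʳ k a w))
  ... | right u | left w  with () ← trans (sym (classOf-↑ʳ k a u)) (trans cₛ≡cₜ (classOf-↑ˡ k a w))

-- Whether suc u lies in b ∷ U does not depend on b.
product-filter-∈ : ∀ b (U : Subset r) (f : Fin (suc r) → ℕ) us →
  product (List.map f (filter (_∈? (b ∷ U)) (List.map suc us))) ≡
  product (List.map (f ∘ suc) (filter (_∈? U) us))
product-filter-∈ b U f []       = refl
product-filter-∈ b U f (u ∷ us) with u ∈? U
... | yes _ = cong (f (suc u) *_) (product-filter-∈ b U f us)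
... | no  _ = product-filter-∈ b U f us

∏-over-outside : ∀ (U : Subset r) f → ∏-over (outside ∷ U) f ≡ ∏-over U (f ∘ suc)
∏-over-outside {r} U f = trans
  (cong (λ us → product (List.map f (filter (_∈? (outside ∷ U)) us))) (sym (map-tabulate id suc)))
  (product-filter-∈ outside U f (allFin r))

∏-over-inside : ∀ (U : Subset r) f → ∏-over (inside ∷ U) f ≡ f zero * ∏-over U (f ∘ suc)
∏-over-inside {r} U f = cong (f zero *_) (trans
  (cong (λ us → product (List.map f (filter (_∈? (inside ∷ U)) us))) (sym (map-tabulate id suc)))
  (product-filter-∈ inside U f (allFin r)))

-- Only m = 0 and m = 1 contribute, so f m may be replaced by its value there.
select-weight : ∀ m t (f : ℕ → ℕ) →
  (⟦ m ℕ.≟ 0 ⟧ + ⟦ m ℕ.≟ 1 ⟧) * t * f m ≡ ⟦ m ℕ.≟ 0 ⟧ * (t * f 0) + ⟦ m ℕ.≟ 1 ⟧ * (t * f 1)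
select-weight 0             t f = trans (cong (_* f 0) (ℕ.*-identityˡ t))
  (sym (trans (ℕ.+-identityʳ _) (ℕ.*-identityˡ (t * f 0))))
select-weight 1             t f = trans (cong (_* f 1) (ℕ.*-identityˡ t)) (sym (ℕ.*-identityˡ (t * f 1)))
select-weight (suc (suc m)) t f = refl

-- Induction on the classes: either the first class is missed, and U does not
-- contain it, or one of its k vertices is chosen, and U contains it.  The function f
-- is arbitrary because the second case replaces it by f ∘ suc.
∑-transversal : ∀ (a : Vec ℕ r) (f : ℕ → ℕ) →
  ∑[ x ∈ words (sum a) ] (⟦ transversal? (classOf a) x ⟧ * f (weight x)) ≡
  ∑[ U ∈ subsets r ] (f ∣ U ∣ * ∏-over U (lookup a))
∑-transversal []      f = cong (_+ 0) (ℕ.*-comm 1 (f 0))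
∑-transversal {suc r} (k ∷ a) f = begin
  ∑[ z ∈ words (k + sum a) ] (⟦ transversal? (classOf (k ∷ a)) z ⟧ * f (weight z))
    ≡⟨ ∑-words-++ k (sum a) _ ⟩
  ∑[ x ∈ words k ] ∑[ y ∈ words (sum a) ] (⟦ transversal? (classOf (k ∷ a)) (x ++ y) ⟧ * f (weight (x ++ y)))
    ≡⟨ ∑-cong (words k) inner ⟩
  ∑[ x ∈ words k ] (⟦ weight x ℕ.≟ 0 ⟧ * h 0 + ⟦ weight x ℕ.≟ 1 ⟧ * h 1)
    ≡⟨ ∑-+ (words k) _ _ ⟩
  ∑[ x ∈ words k ] (⟦ weight x ℕ.≟ 0 ⟧ * h 0) + ∑[ x ∈ words k ] (⟦ weight x ℕ.≟ 1 ⟧ * h 1)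
    ≡⟨ cong₂ _+_ (∑-*ʳ (words k) (h 0) _) (∑-*ʳ (words k) (h 1) _) ⟩
  ∑[ x ∈ words k ] ⟦ weight x ℕ.≟ 0 ⟧ * h 0 + ∑[ x ∈ words k ] ⟦ weight x ℕ.≟ 1 ⟧ * h 1
    ≡⟨ cong₂ (λ c d → c * h 0 + d * h 1) (#weight k 0) (trans (#weight k 1) (nC1≡n k)) ⟩
  1 * h 0 + k * h 1
    ≡⟨ cong (_+ k * h 1) (ℕ.*-identityˡ (h 0)) ⟩
  h 0 + k * h 1
    ≡⟨ cong₂ (λ c d → c + k * d) (∑-transversal a f) (∑-transversal a (f ∘ suc)) ⟩
  ∑[ U ∈ subsets r ] (f ∣ U ∣ * ∏-over U (lookup a)) +
  k * ∑[ U ∈ subsets r ] (f (suc ∣ U ∣) * ∏-over U (lookup a))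
    ≡⟨ cong₂ _+_ (∑-cong (subsets r) λ U → cong (f ∣ U ∣ *_) (sym (∏-over-outside U (lookup (k ∷ a)))))
                 (trans (sym (∑-*ˡ (subsets r) k _)) (∑-cong (subsets r) insideTerm)) ⟩
  ∑[ U ∈ subsets r ] (f ∣ U ∣ * ∏-over (outside ∷ U) (lookup (k ∷ a))) +
  ∑[ U ∈ subsets r ] (f (suc ∣ U ∣) * ∏-over (inside ∷ U) (lookup (k ∷ a)))
    ≡⟨ ∑-vecs outside inside r _ ⟨
  ∑[ U ∈ subsets (suc r) ] (f ∣ U ∣ * ∏-over U (lookup (k ∷ a))) ∎
  where
  open ≡-Reasoning
  -- The contribution of the other classes when m vertices are chosen in the
  -- first one.
  h : ℕ → ℕ
  h m = ∑[ y ∈ words (sum a) ] (⟦ transversal? (classOf a) y ⟧ * f (m + weight y))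

  insideTerm : ∀ U → k * (f (suc ∣ U ∣) * ∏-over U (lookup a)) ≡
                     f (suc ∣ U ∣) * ∏-over (inside ∷ U) (lookup (k ∷ a))
  insideTerm U = begin
    k * (f (suc ∣ U ∣) * ∏-over U (lookup a))  ≡⟨ *-x∙yz≈y∙xz k (f (suc ∣ U ∣)) _ ⟩
    f (suc ∣ U ∣) * (k * ∏-over U (lookup a))  ≡⟨ cong (f (suc ∣ U ∣) *_) (∏-over-inside U (lookup (k ∷ a))) ⟨
    f (suc ∣ U ∣) * ∏-over (inside ∷ U) (lookup (k ∷ a)) ∎
    where
    open import Algebra.Properties.CommutativeSemigroup ℕ.*-commutativeSemigroup
      using () renaming (x∙yz≈y∙xz to *-x∙yz≈y∙xz)

  term : ∀ x y → ⟦ transversal? (classOf (k ∷ a)) (x ++ y) ⟧ * f (weight (x ++ y)) ≡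
                 ⟦ weight x ℕ.≟ 0 ⟧ * (⟦ transversal? (classOf a) y ⟧ * f (0 + weight y)) +
                 ⟦ weight x ℕ.≟ 1 ⟧ * (⟦ transversal? (classOf a) y ⟧ * f (1 + weight y))
  term x y = begin
    ⟦ transversal? (classOf (k ∷ a)) (x ++ y) ⟧ * f (weight (x ++ y))
      ≡⟨ cong₂ _*_ bracket (cong f (weight-++ x y)) ⟩
    (⟦ weight x ℕ.≟ 0 ⟧ + ⟦ weight x ℕ.≟ 1 ⟧) * ⟦ transversal? (classOf a) y ⟧ * f (weight x + weight y)
      ≡⟨ select-weight (weight x) _ (λ m → f (m + weight y)) ⟩
    ⟦ weight x ℕ.≟ 0 ⟧ * (⟦ transversal? (classOf a) y ⟧ * f (0 + weight y)) +
    ⟦ weight x ℕ.≟ 1 ⟧ * (⟦ transversal? (classOf a) y ⟧ * f (1 + weight y)) ∎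
    where
    ≤1? = (weight x ℕ.≟ 0) ⊎-dec (weight x ℕ.≟ 1)
    bracket : ⟦ transversal? (classOf (k ∷ a)) (x ++ y) ⟧ ≡
              (⟦ weight x ℕ.≟ 0 ⟧ + ⟦ weight x ℕ.≟ 1 ⟧) * ⟦ transversal? (classOf a) y ⟧
    bracket = begin
      ⟦ transversal? (classOf (k ∷ a)) (x ++ y) ⟧
        ≡⟨ ⟦⟧-cong (transversal-++⇔ k a x y) (transversal? (classOf (k ∷ a)) (x ++ y)) (≤1? ×-dec transversal? (classOf a) y) ⟩
      ⟦ ≤1? ×-dec transversal? (classOf a) y ⟧
        ≡⟨ ⟦⟧-× ≤1? (transversal? (classOf a) y) ⟩
      ⟦ ≤1? ⟧ * ⟦ transversal? (classOf a) y ⟧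
        ≡⟨ cong (_* ⟦ transversal? (classOf a) y ⟧)
                (⟦⟧-⊎ (λ ∣x∣≡0 ∣x∣≡1 → ℕ.0≢1+n (trans (sym ∣x∣≡0) ∣x∣≡1)) (weight x ℕ.≟ 0) (weight x ℕ.≟ 1)) ⟩
      (⟦ weight x ℕ.≟ 0 ⟧ + ⟦ weight x ℕ.≟ 1 ⟧) * ⟦ transversal? (classOf a) y ⟧ ∎

  inner : ∀ x → ∑[ y ∈ words (sum a) ] (⟦ transversal? (classOf (k ∷ a)) (x ++ y) ⟧ * f (weight (x ++ y))) ≡
                ⟦ weight x ℕ.≟ 0 ⟧ * h 0 + ⟦ weight x ℕ.≟ 1 ⟧ * h 1
  inner x = trans (∑-cong (words (sum a)) (term x)) (trans (∑-+ (words (sum a)) _ _)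
    (cong₂ _+_ (∑-*ˡ (words (sum a)) ⟦ weight x ℕ.≟ 0 ⟧ _) (∑-*ˡ (words (sum a)) ⟦ weight x ℕ.≟ 1 ⟧ _)))

-- The number of minimal codewords

proposition3p5 : (r : ℕ) → 3 ≤ r → (a : Vec ℕ r) → (∀ i → 1 ≤ lookup a i) →
    let n = sum a in
    M (completeMultipartite a) ≡ n + (n C 2) + ∑-over oddAtLeast3? (λ U → ∏-over U (lookup a))
proposition3p5 r 3≤r a 1≤a = begin
  M (completeMultipartite a)
    ≡⟨ M≡∑-encode (completeMultipartite a) ⟩
  ∑[ x ∈ ws ] ⟦ minimal? (completeMultipartite a) (encode (completeMultipartite a) x) ⟧
    ≡⟨ ∑-cong ws bracket ⟩
  ∑[ x ∈ ws ] (⟦ weight x ℕ.≟ 1 ⟧ + ⟦ weight x ℕ.≟ 2 ⟧ + ⟦ transversal? (classOf a) x ⟧ * ⟦ odd≥3? (weight x) ⟧)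
    ≡⟨ ∑-+ ws _ _ ⟩
  ∑[ x ∈ ws ] (⟦ weight x ℕ.≟ 1 ⟧ + ⟦ weight x ℕ.≟ 2 ⟧) +
  ∑[ x ∈ ws ] (⟦ transversal? (classOf a) x ⟧ * ⟦ odd≥3? (weight x) ⟧)
    ≡⟨ cong₂ _+_ (∑-+ ws _ _) (∑-transversal a (λ m → ⟦ odd≥3? m ⟧)) ⟩
  ∑[ x ∈ ws ] ⟦ weight x ℕ.≟ 1 ⟧ + ∑[ x ∈ ws ] ⟦ weight x ℕ.≟ 2 ⟧ +
  ∑[ U ∈ subsets r ] (⟦ oddAtLeast3? U ⟧ * ∏-over U (lookup a))
    ≡⟨ cong₂ _+_ (cong₂ _+_ (trans (#weight (sum a) 1) (nC1≡n (sum a))) (#weight (sum a) 2))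
                 (sym (∑-filter oddAtLeast3? (subsets r) (λ U → ∏-over U (lookup a)))) ⟩
  sum a + (sum a C 2) + ∑-over oddAtLeast3? (λ U → ∏-over U (lookup a)) ∎
  where
  open ≡-Reasoning
  open Multipartite a
  ws = words (sum a)
  odd≥3? : ∀ m → Dec (m % 2 ≡ 1 × 3 ≤ m)
  odd≥3? m = (m % 2 ℕ.≟ 1) ×-dec (3 ℕ.≤? m)

  bracket : ∀ x → ⟦ minimal? G (encode G x) ⟧ ≡
    ⟦ weight x ℕ.≟ 1 ⟧ + ⟦ weight x ℕ.≟ 2 ⟧ + ⟦ transversal? (classOf a) x ⟧ * ⟦ odd≥3? (weight x) ⟧
  bracket x = begin
    ⟦ minimal? G (encode G x) ⟧
      ≡⟨ ⟦⟧-cong (minimal⇔shape 3≤r (classOf-onto a 1≤a) x) (minimal? G (encode G x)) (small? ⊎-dec large?) ⟩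
    ⟦ small? ⊎-dec large? ⟧
      ≡⟨ ⟦⟧-⊎ small-large small? large? ⟩
    ⟦ small? ⟧ + ⟦ large? ⟧
      ≡⟨ cong₂ _+_ (⟦⟧-⊎ (λ ≡1 ≡2 → contradiction (trans (sym ≡1) ≡2) λ ()) (weight x ℕ.≟ 1) (weight x ℕ.≟ 2))
                   (⟦⟧-× (transversal? (classOf a) x) (odd≥3? (weight x))) ⟩
    ⟦ weight x ℕ.≟ 1 ⟧ + ⟦ weight x ℕ.≟ 2 ⟧ + ⟦ transversal? (classOf a) x ⟧ * ⟦ odd≥3? (weight x) ⟧ ∎
    where
    small? = (weight x ℕ.≟ 1) ⊎-dec (weight x ℕ.≟ 2)
    large? = transversal? (classOf a) x ×-dec odd≥3? (weight x)
    small-large : weight x ≡ 1 ⊎ weight x ≡ 2 →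
                  ¬ (Transversal (classOf a) x × weight x % 2 ≡ 1 × 3 ≤ weight x)
    small-large (inj₁ ≡1) (_ , _ , 3≤) = contradiction (subst (3 ≤_) ≡1 3≤) λ { (s≤s ()) }
    small-large (inj₂ ≡2) (_ , _ , 3≤) = contradiction (subst (3 ≤_) ≡2 3≤) λ { (s≤s (s≤s ())) }
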